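{- Let $G=(V,E,w)$ be a finite connected graph with $|V|=n\ge2$ and weights $w:E\to\mathbb{R}_{>0}$. Then $$\operatorname{OPT}_D^-(G,w)=\operatorname{OPT}_{\mathrm{card}}(G,w)=\min_{T\in\mathcal T_{\mathrm{conn}}^{\mathrm{bin}}(G)}\ \sum_{xy\in E}w_{xy}h_T(x,y).$$ Moreover, for every $T\in\mathcal T_{\mathrm{conn}}^{\mathrm{bin}}(G)$ and all distinct $x,y\in V$, $$d_G(x,y)\le\operatorname{diam}_{d_G}\bigl(C_T(x,y)\bigr)\le|C_T(x,y)|-1=h_T(x,y)$$ (for $x=y$ all terms are $0$). Thus $h_T\ge d_G$ on all pairs in $V\times V$, not only on the edges.
   Context: $d_G$ is the shortest-path metric of the support graph $(V,E)$ with every edge of length $1$; the weights are not edge lengths. $\operatorname{diam}_{d_G}(S)=\max_{a,b\in S}d_G(a,b)$. A rooted binary hierarchy $T$ on $V$ is a rooted tree whose leaves are the vertices of $V$ and whose internal nodes have exactly two children; each node is identified with the set of leaves in its subtree (a cluster), and $C_T(x,y)$ is the cluster of the lowest common ancestor of $x,y$ (so $C_T(x,x)=\{x\}$). $\mathcal T_{\mathrm{bin}}(V)$ is the set of all rooted binary hierarchies on $V$, and $\mathcal T_{\mathrm{conn}}^{\mathrm{bin}}(G)$ the subset of those all of whose clusters induce connected subgraphs of $G$. The shifted cardinality labeling is $h_T(x,x)=0$ and $h_T(x,y)=|C_T(x,y)|-1$ for $x\neq y$. $\operatorname{OPT}_D^-(G,w)=\min_{T\in\mathcal T_{\mathrm{bin}}(V)}\sum_{xy\in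 E}w_{xy}(|C_T(x,y)|-1)$ is the shifted Dasgupta optimum. $\operatorname{OPT}_{\mathrm{card}}(G,w)$ is the minimum of $\sum_{xy\in E}w_{xy}h_H(x,y)$ over all $H\in\mathcal T_{\mathrm{bin}}(V)$ with $h_H(x,y)\ge d_G(x,y)$ for all $x,y\in V$. -}

module Defs where

open import Algebra.Bundles using (CommutativeRing)
open import Data.Bool.Base using (if_then_else_)
open import Data.Fin.Base using (Fin)
import Data.Fin.Base as Fin
import Data.Fin.Properties as Fin
open import Data.Fin.Subset using (Subset; _∈_; _∪_; ⁅_⁆; ∣_∣) renaming (⊤ to full)
open import Data.Fin.Subset.Properties using (_∈?_; ∈⊤)
open import Data.List.Base
  using (List; allFin; cartesianProduct; cartesianProductWith; filter; foldr; map)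
open import Data.List.Extrema.Nat using (max)
open import Data.List.Relation.Binary.Permutation.Propositional using (_↭_)
open import Data.Nat.Base using (ℕ; zero; suc; _∸_; _≤_; z≤n; s≤s)
open import Data.Product.Base using (∃-syntax; _×_; _,_; proj₁; proj₂)
open import Data.Tree.Binary using (Tree; leaf; node; module Leaves)
open import Data.Unit.Base using () renaming (⊤ to Unit)
open import Function.Base using (_∘_)
open import Level using (Level; _⊔_; 0ℓ) renaming (suc to lsuc)
open import Relation.Binary.Core using (Rel)
open import Relation.Binary.Definitions using (Decidable; Symmetric; Irreflexive)
open import Relation.Binary.PropositionalEquality.Core using (_≡_; refl)
open import Relation.Binary.Structures using (IsTotalOrder)
import Relation.Binary.Construct.NonStrictToStrict as NonStrictToStrict
open import Relation.Nullary.Decidable.Core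
  using (Dec; yes; no; does; map′; _×-dec_)
open import Relation.Nullary.Negation.Core using (¬_; contradiction)
import Relation.Unary as Pred
open import Relation.Unary using (Pred)

-- Stands in for ℝ, which agda-stdlib lacks: classically, ℝ is an instance.
record OrderedField c ℓ₁ ℓ₂ : Set (lsuc (c ⊔ ℓ₁ ⊔ ℓ₂)) where
  field
    commutativeRing : CommutativeRing c ℓ₁
  open CommutativeRing commutativeRing public
  infix 4 _≤ᶠ_
  field
    _≤ᶠ_         : Rel Carrier ℓ₂
    isTotalOrder : IsTotalOrder _≈_ _≤ᶠ_
    +-monoʳ-≤ᶠ   : ∀ z {x y} → x ≤ᶠ y → z + x ≤ᶠ z + y
    *-nonneg     : ∀ {x y} → 0# ≤ᶠ x → 0# ≤ᶠ y → 0# ≤ᶠ x * y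
    1≉0          : ¬ (1# ≈ 0#)
    inverse      : ∀ x → ¬ (x ≈ 0#) → ∃[ y ] x * y ≈ 1#

  open NonStrictToStrict _≈_ _≤ᶠ_ public using () renaming (_<_ to infix 4 _<ᶠ_)

  fromℕ : ℕ → Carrier
  fromℕ zero    = 0#
  fromℕ (suc k) = 1# + fromℕ k

  sum : List Carrier → Carrier
  sum = foldr _+_ 0#

  -- v = min { f a | a satisfies P }, the minimum being attained.
  IsMinimum : ∀ {a p} {A : Set a} → Pred A p → (A → Carrier) → Carrier →
              Set (a ⊔ p ⊔ ℓ₁ ⊔ ℓ₂)
  IsMinimum P f v = (∃[ a ] P a × f a ≈ v) × (∀ a → P a → v ≤ᶠ f a)

record Graph (n : ℕ) : Set₁ where
  field
    Adj    : Rel (Fin n) 0ℓ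
    adj?   : Decidable Adj
    symm   : Symmetric Adj
    irrefl : Irreflexive _≡_ Adj

  -- Each unordered edge xy is listed once, as the pair with x < y.
  edges : List (Fin n × Fin n)
  edges = filter (λ (x , y) → (x Fin.<? y) ×-dec adj? x y)
                 (cartesianProduct (allFin n) (allFin n))

  -- Walks with k edges in the subgraph induced by S.
  data Walk (S : Subset n) : ℕ → Fin n → Fin n → Set where
    here : ∀ {x} → x ∈ S → Walk S 0 x x
    step : ∀ {k x y z} → x ∈ S → Adj x y → Walk S k y z → Walk S (suc k) x z

  InducesConnected : Subset n → Set
  InducesConnected S = ∀ {x y} → x ∈ S → y ∈ S → ∃[ k ] Walk S k x y

  Connected : Set
  Connected = InducesConnected full

  walk? : ∀ S k x y → Dec (Walk S k x y)
  walk? S zero x y =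
    map′ (λ { (refl , x∈S) → here x∈S }) (λ { (here x∈S) → refl , x∈S })
         ((x Fin.≟ y) ×-dec (x ∈? S))
  walk? S (suc k) x z =
    map′ (λ { (x∈S , _ , xy , p) → step x∈S xy p })
         (λ { (step x∈S xy p) → x∈S , _ , xy , p })
         ((x ∈? S) ×-dec Fin.any? (λ y → adj? x y ×-dec walk? S k y z))

  IsDistance : Fin n → Fin n → ℕ → Set
  IsDistance x y k = Walk full k x y × (∀ {j} → Walk full j x y → k ≤ j)

least : ∀ {p} {P : Pred ℕ p} → Pred.Decidable P → ∀ {k} → P k →
        ∃[ m ] P m × (∀ {j} → P j → m ≤ j)
least P? {zero} p = 0 , p , λ _ → z≤n
least {P = P} P? {suc k} p with P? 0 | least {P = P ∘ suc} (P? ∘ suc) p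
... | yes p₀ | _              = 0 , p₀ , λ _ → z≤n
... | no ¬p₀ | m , pₘ , m-min =
  suc m , pₘ , λ { {zero} p₀ → contradiction p₀ ¬p₀ ; {suc j} q → s≤s (m-min q) }

module Metric {n} (G : Graph n) (conn : Graph.Connected G) where
  open Graph G

  distance : ∀ x y → ∃[ k ] IsDistance x y k
  distance x y = least (λ k → walk? full k x y) (proj₂ (conn ∈⊤ ∈⊤))

  d : Fin n → Fin n → ℕ
  d x y = proj₁ (distance x y)

  -- The default value 0 of max only matters for S = ∅.
  diam : Subset n → ℕ
  diam S = max 0 (cartesianProductWith d members members)
    where members = filter (_∈? S) (allFin n)

BinTree : ℕ → Set
BinTree n = Tree Unit (Fin n)

cluster : ∀ {n} → BinTree n → Subset n
cluster (leaf v)     = ⁅ v ⁆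
cluster (node l _ r) = cluster l ∪ cluster r

-- The subtrees of t correspond to its nodes.
data _IsSubtreeOf_ {n} (s : BinTree n) : BinTree n → Set where
  root  : s IsSubtreeOf s
  left  : ∀ {l u r} → s IsSubtreeOf l → s IsSubtreeOf node l u r
  right : ∀ {l u r} → s IsSubtreeOf r → s IsSubtreeOf node l u r

-- The subtree at the lowest common ancestor of x and y (meaningful when
-- x and y are both leaves): descend while a child contains both.
lca : ∀ {n} → BinTree n → Fin n → Fin n → BinTree n
lca (leaf v)     x y = leaf v
lca (node l u r) x y =
  if does ((x ∈? cluster l) ×-dec (y ∈? cluster l)) then lca l x y
  else if does ((x ∈? cluster r) ×-dec (y ∈? cluster r)) then lca r x y
  else node l u r

-- Children are ordered here, so a hierarchy has several representatives;
-- they have the same clusters.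
record Hierarchy (n : ℕ) : Set where
  field
    tree    : BinTree n
    leaves↭ : Leaves.toList tree ↭ allFin n

  C : Fin n → Fin n → Subset n
  C x y = cluster (lca tree x y)

  h : Fin n → Fin n → ℕ
  h x y = if does (x Fin.≟ y) then 0 else ∣ C x y ∣ ∸ 1

  ConnectedClusters : Graph n → Set
  ConnectedClusters G =
    ∀ {s} → s IsSubtreeOf tree → Graph.InducesConnected G (cluster s)

module _ {c ℓ₁ ℓ₂} (K : OrderedField c ℓ₁ ℓ₂) where
  open OrderedField K using (Carrier; _≈_; 0#; _*_; _<ᶠ_; fromℕ; sum; IsMinimum)

  -- Values of w outside the edges are never used.
  record WeightedGraph (n : ℕ) : Set (lsuc 0ℓ ⊔ c ⊔ ℓ₁ ⊔ ℓ₂) where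
    field
      graph : Graph n
    open Graph graph public
    field
      w      : Fin n → Fin n → Carrier
      w-symm : ∀ {x y} → Adj x y → w x y ≈ w y x
      w-pos  : ∀ {x y} → Adj x y → 0# <ᶠ w x y

    edgeSum : (Fin n → Fin n → ℕ) → Carrier
    edgeSum f = sum (map (λ (x , y) → w x y * fromℕ (f x y)) edges)

    IsOPT-D⁻ : Carrier → Set (ℓ₁ ⊔ ℓ₂)
    IsOPT-D⁻ = IsMinimum {A = Hierarchy n} Pred.U
      (λ T → edgeSum (λ x y → ∣ Hierarchy.C T x y ∣ ∸ 1))

    IsOPT-card : Connected → Carrier → Set (ℓ₁ ⊔ ℓ₂)
    IsOPT-card conn = IsMinimum {A = Hierarchy n}
      (λ H → ∀ x y → Metric.d graph conn x y ≤ Hierarchy.h H x y)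
      (λ H → edgeSum (Hierarchy.h H))

    IsOPT-conn : Carrier → Set (ℓ₁ ⊔ ℓ₂)
    IsOPT-conn = IsMinimum {A = Hierarchy n}
      (λ T → Hierarchy.ConnectedClusters T graph)
      (λ T → edgeSum (Hierarchy.h T))

{-# OPTIONS --safe #-}
module Submission where

-- The three optima agree because any hierarchy T can be replaced by a
-- hierarchy T* with connected clusters such that, on every edge xy, the
-- cluster of T* joining x and y is contained in that of T.  Since all
-- weights are positive, T* costs at most as much as T.  To obtain T*, split
-- every cluster of T into its connected components, bottom up: the
-- components of a node arise from those of its two children by merging,
-- one pair at a time, trees joined by an edge (`components`).  Two facts
-- carry the argument.  The trees left in the end are pairwise separated, so
-- an edge inside a cluster of T never leaves a component of it; and merging
-- only adds nodes on top, so components made early survive as subtrees.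
-- Hence the endpoints of an edge inside a cluster of T always lie in a
-- subtree of the result contained in that cluster (`components-refine`).
-- As G is connected, only one tree is left at the root of T.
--
-- For a connected cluster S, any two of its vertices are joined inside S by
-- a path without repeated vertices, so by at most |S| - 1 edges
-- (`shorten`); this bounds the diameter, and makes every connected hierarchy
-- feasible for the problem constrained by the distance.  The optima thus
-- all equal the cost of T*, for T of least Dasgupta cost.  Such a T exists
-- because only finitely many trees have the right leaves and the order of
-- the field is total (`hierarchy-argmin`).

open import Defs
import Algebra.Properties.Group as GroupProperties
import Algebra.Properties.Ring as RingProperties
open import Data.Bool.Base using (if_then_else_)
open import Data.Fin.Base using (Fin)
import Data.Fin.Base as Fin
import Data.Fin.Properties as Fin
open import Data.Fin.Subset using (Subset; _∈_; _⊆_; _-_; ∣_∣; Nonempty) renaming (⊤ to full)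
open import Data.Fin.Subset.Properties
  using (_∈?_; ∈⊤; x∈⁅x⁆; x∈⁅y⁆⇒x≡y; ∣⁅x⁆∣≡1; x∈p∪q⁻; p⊆p∪q; q⊆p∪q; p─q⊆p;
         x∈p∧x≢y⇒x∈p-y; x∈p⇒∣p-x∣<∣p∣; p⊆q⇒∣p∣≤∣q∣)
open import Data.List.Base
  using (List; []; _∷_; _++_; allFin; cartesianProduct; cartesianProductWith;
         concatMap; filter; foldr; length; map; tabulate)
import Data.List.Extrema as Extrema
open import Data.List.Extrema.Nat using (max≤v⁺; v≤max⁺)
open import Data.List.Membership.Propositional using (find; lose) renaming (_∈_ to _∈ˡ_)
open import Data.List.Membership.Propositional.Properties
  using (∈-++⁺ˡ; ∈-++⁺ʳ; ∈-++⁻; ∈-allFin; ∈-cartesianProductWith⁺; ∈-cartesianProductWith⁻;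
         ∈-concatMap⁺; ∈-concatMap⁻; ∈-filter⁺; ∈-filter⁻; ∈-map⁺; ∈-∃++)
open import Data.List.Properties
  using (++-assoc; ++-identityʳ; length-++; length-tabulate; map-cong-local)
open import Data.List.Relation.Binary.Permutation.Propositional
  using (_↭_; ↭-refl; ↭-reflexive; ↭-sym; ↭-trans; ↭⇒↭ₛ; prep; module PermutationReasoning)
open import Data.List.Relation.Binary.Permutation.Propositional.Properties
  using (∈-resp-↭; ++⁺; ++⁺ˡ; shift; shifts; drop-∷; ¬x∷xs↭[]; ↭-length)
import Data.List.Relation.Binary.Permutation.Setoid.Properties as Permutationₛ
open import Data.List.Relation.Unary.All as All using (All; []; _∷_)
open import Data.List.Relation.Unary.All.Properties using (all-filter)
open import Data.List.Relation.Unary.AllPairs using (AllPairs; []; _∷_)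
open import Data.List.Relation.Unary.Any as Any using (Any; here; there)
open import Data.List.Relation.Unary.Unique.Propositional using (Unique)
open import Data.List.Relation.Unary.Unique.Propositional.Properties using (allFin⁺)
open import Data.Nat.Base using (ℕ; zero; suc; _∸_; _≤_; _<_; z≤n; s≤s; s≤s⁻¹)
open import Data.Nat.Induction using (Acc; acc; <-wellFounded)
import Data.Nat.Properties as ℕ
open import Data.Product.Base using (_×_; _,_; ∃-syntax; proj₁; proj₂)
open import Data.Sum.Base using (_⊎_; inj₁; inj₂; [_,_]′)
open import Data.Tree.Binary using (leaf; node; module Leaves)
open import Function.Base using (_∘_; id)
open import Relation.Binary.Bundles using (TotalOrder)
open import Relation.Binary.PropositionalEquality
  using (_≡_; _≢_; refl; sym; trans; cong; subst; setoid; module ≡-Reasoning)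
open import Relation.Nullary using (Dec; yes; no; does; ¬_; contradiction)
open import Relation.Nullary.Decidable using (map′; _×-dec_)

open Leaves using (toList)

private variable
  n : ℕ

-- Lists

unique-++⇒disjoint : ∀ {a} {A : Set a} (xs : List A) {ys z} →
                     Unique (xs ++ ys) → z ∈ˡ xs → ¬ z ∈ˡ ys
unique-++⇒disjoint (x ∷ xs) (x≢ ∷ _) (here refl) z∈ys =
  All.lookup x≢ (∈-++⁺ʳ xs z∈ys) refl
unique-++⇒disjoint (x ∷ xs) (_ ∷ u) (there z∈xs) z∈ys =
  unique-++⇒disjoint xs u z∈xs z∈ys

unique-++ˡ : ∀ {a} {A : Set a} (xs : List A) {ys} → Unique (xs ++ ys) → Unique xs
unique-++ˡ []       _        = []
unique-++ˡ (x ∷ xs) (x≢ ∷ u) =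
  All.tabulate (λ z∈xs → All.lookup x≢ (∈-++⁺ˡ z∈xs)) ∷ unique-++ˡ xs u

unique-++ʳ : ∀ {a} {A : Set a} (xs : List A) {ys} → Unique (xs ++ ys) → Unique ys
unique-++ʳ []       u       = u
unique-++ʳ (x ∷ xs) (_ ∷ u) = unique-++ʳ xs u

module _ {a} {A : Set a} (_≟_ : (x y : A) → Dec (x ≡ y)) where
  infix 4 _↭?_
  _↭?_ : (xs ys : List A) → Dec (xs ↭ ys)
  [] ↭? []       = yes ↭-refl
  [] ↭? (y ∷ ys) = no (¬x∷xs↭[] ∘ ↭-sym)
  (x ∷ xs) ↭? ys with Any.any? (x ≟_) ys
  ... | no x∉ys = no (λ p → x∉ys (∈-resp-↭ p (here refl)))
  ... | yes x∈ys with ∈-∃++ x∈ys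
  ...   | as , bs , refl =
    map′ (λ p → ↭-trans (prep x p) (↭-sym (shift x as bs)))
         (λ p → drop-∷ (↭-trans p (shift x as bs)))
         (xs ↭? as ++ bs)

-- Trees and their clusters

-- The leaf list is computed by difference lists; this makes it compositional.

toDiffList-++ : (t : BinTree n) (xs : List (Fin n)) →
                Leaves.toDiffList t xs ≡ toList t ++ xs
toDiffList-++ (leaf v)     xs = refl
toDiffList-++ (node l u r) xs = begin
  Leaves.toDiffList l (Leaves.toDiffList r xs) ≡⟨ toDiffList-++ l _ ⟩
  toList l ++ Leaves.toDiffList r xs           ≡⟨ cong (toList l ++_) (toDiffList-++ r xs) ⟩
  toList l ++ (toList r ++ xs)                 ≡⟨ ++-assoc (toList l) _ _ ⟨
  (toList l ++ toList r) ++ xs                 ≡⟨ cong (_++ xs) (toDiffList-++ l (toList r)) ⟨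
  toList (node l u r) ++ xs                    ∎
  where open ≡-Reasoning

toList-node : ∀ (l : BinTree n) {u} r → toList (node l u r) ≡ toList l ++ toList r
toList-node l r = toDiffList-++ l (toList r)

∈-cluster⇒∈-toList : ∀ (t : BinTree n) {x} → x ∈ cluster t → x ∈ˡ toList t
∈-cluster⇒∈-toList (leaf v)     x∈ = here (x∈⁅y⁆⇒x≡y v x∈)
∈-cluster⇒∈-toList (node l u r) x∈ =
  subst (_ ∈ˡ_) (sym (toList-node l r))
    ([ ∈-++⁺ˡ ∘ ∈-cluster⇒∈-toList l , ∈-++⁺ʳ (toList l) ∘ ∈-cluster⇒∈-toList r ]′
      (x∈p∪q⁻ (cluster l) (cluster r) x∈))

∈-toList⇒∈-cluster : ∀ (t : BinTree n) {x} → x ∈ˡ toList t → x ∈ cluster t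
∈-toList⇒∈-cluster (leaf v)     (here refl) = x∈⁅x⁆ v
∈-toList⇒∈-cluster (node l u r) x∈ =
  [ p⊆p∪q (cluster r) ∘ ∈-toList⇒∈-cluster l
  , q⊆p∪q (cluster l) (cluster r) ∘ ∈-toList⇒∈-cluster r ]′
    (∈-++⁻ (toList l) (subst (_ ∈ˡ_) (toList-node l r) x∈))

cluster-nonempty : (t : BinTree n) → Nonempty (cluster t)
cluster-nonempty (leaf v)     = v , x∈⁅x⁆ v
cluster-nonempty (node l u r) with x , x∈l ← cluster-nonempty l = x , p⊆p∪q (cluster r) x∈l

subtree⇒⊆ : ∀ {s t : BinTree n} → s IsSubtreeOf t → cluster s ⊆ cluster t
subtree⇒⊆ root                          x∈s = x∈s
subtree⇒⊆ {t = node l _ r} (left  s⊑l)  x∈s = p⊆p∪q (cluster r) (subtree⇒⊆ s⊑l x∈s)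
subtree⇒⊆ {t = node l _ r} (right s⊑r)  x∈s = q⊆p∪q (cluster l) (cluster r) (subtree⇒⊆ s⊑r x∈s)

-- Lowest common ancestors

Joins : BinTree n → Fin n → Fin n → Set
Joins t x y = x ∈ cluster t × y ∈ cluster t

joins-mono : ∀ {s t : BinTree n} {x y} → s IsSubtreeOf t → Joins s x y → Joins t x y
joins-mono s⊑t (x∈s , y∈s) = subtree⇒⊆ s⊑t x∈s , subtree⇒⊆ s⊑t y∈s

if-does-elim : ∀ {a p q} {A : Set a} {Q : Set q} (P : A → Set p) (Q? : Dec Q) {x y : A} →
               (Q → P x) → (¬ Q → P y) → P (if does Q? then x else y)
if-does-elim P (yes q) px py = px q
if-does-elim P (no ¬q) px py = py ¬q

-- Replaces unfolding the nested conditionals: to prove P of the lowest common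
-- ancestor at a node, treat the three outcomes of the descent.
lca-elim : ∀ {p} (P : BinTree n → Set p) (l : BinTree n) {u} r {x y} →
           (Joins l x y → P (lca l x y)) →
           (Joins r x y → P (lca r x y)) →
           (¬ Joins l x y → ¬ Joins r x y → P (node l u r)) →
           P (lca (node l u r) x y)
lca-elim P l r {x} {y} inˡ inʳ split =
  if-does-elim P ((x ∈? cluster l) ×-dec (y ∈? cluster l)) inˡ λ ∉l →
  if-does-elim P ((x ∈? cluster r) ×-dec (y ∈? cluster r)) inʳ λ ∉r →
  split ∉l ∉r

lca-subtree : ∀ (t : BinTree n) x y → lca t x y IsSubtreeOf t
lca-subtree (leaf v)     x y = root
lca-subtree (node l u r) x y =
  lca-elim (_IsSubtreeOf node l u r) l r
    (λ _ → left (lca-subtree l x y)) (λ _ → right (lca-subtree r x y)) (λ _ _ → root)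

lca-joins : ∀ (t : BinTree n) {x y} → Joins t x y → Joins (lca t x y) x y
lca-joins (leaf v)     xy∈ = xy∈
lca-joins (node l u r) {x} {y} xy∈ =
  lca-elim (λ s → Joins s x y) l r (lca-joins l) (lca-joins r) (λ _ _ → xy∈)

lca-diagonal : ∀ (t : BinTree n) {x} → x ∈ cluster t → lca t x x ≡ leaf x
lca-diagonal (leaf v)     x∈ = cong leaf (sym (x∈⁅y⁆⇒x≡y v x∈))
lca-diagonal (node l u r) x∈ =
  lca-elim (_≡ leaf _) l r (lca-diagonal l ∘ proj₁) (lca-diagonal r ∘ proj₁) λ x∉l x∉r →
    [ (λ x∈l → contradiction (x∈l , x∈l) x∉l) , (λ x∈r → contradiction (x∈r , x∈r) x∉r) ]′
      (x∈p∪q⁻ (cluster l) (cluster r) x∈)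

-- Distinct leaves are essential: they force the descent to follow the path
-- to v as long as it is above v.
lca-minimal : ∀ {t v : BinTree n} {x y} → Unique (toList t) → v IsSubtreeOf t → Joins v x y →
              cluster (lca t x y) ⊆ cluster v
lca-minimal {t = t} u root _ = subtree⇒⊆ (lca-subtree t _ _)
lca-minimal {t = node l _ r} {v} u (left v⊑l) v∋ =
  lca-elim (λ s → cluster s ⊆ cluster v) l r
    (λ _ → lca-minimal (unique-++ˡ (toList l) u′) v⊑l v∋)
    (λ (x∈r , _) → contradiction (∈-cluster⇒∈-toList r x∈r)
       (unique-++⇒disjoint (toList l) u′ (∈-cluster⇒∈-toList l (subtree⇒⊆ v⊑l (proj₁ v∋)))))
    (λ ∉l _ → contradiction (joins-mono v⊑l v∋) ∉l)
  where u′ = subst Unique (toList-node l r) u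
lca-minimal {t = node l _ r} {v} u (right v⊑r) v∋ =
  lca-elim (λ s → cluster s ⊆ cluster v) l r
    (λ (x∈l , _) → contradiction (∈-cluster⇒∈-toList r (subtree⇒⊆ v⊑r (proj₁ v∋)))
       (unique-++⇒disjoint (toList l) u′ (∈-cluster⇒∈-toList l x∈l)))
    (λ _ → lca-minimal (unique-++ʳ (toList l) u′) v⊑r v∋)
    (λ _ ∉r → contradiction (joins-mono v⊑r v∋) ∉r)
  where u′ = subst Unique (toList-node l r) u

module _ (T : Hierarchy n) where
  open Hierarchy T

  ∈-hierarchy : ∀ x → x ∈ cluster tree
  ∈-hierarchy x = ∈-toList⇒∈-cluster tree (∈-resp-↭ (↭-sym leaves↭) (∈-allFin x))

  C-joins : ∀ x y → Joins (lca tree x y) x y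
  C-joins x y = lca-joins tree (∈-hierarchy x , ∈-hierarchy y)

  hierarchy-unique : Unique (toList tree)
  hierarchy-unique =
    Permutationₛ.Unique-resp-↭ (setoid (Fin n)) (↭⇒↭ₛ (↭-sym leaves↭)) (allFin⁺ n)

  h-off-diagonal : ∀ {x y} → x ≢ y → ∣ C x y ∣ ∸ 1 ≡ h x y
  h-off-diagonal {x} {y} x≢y =
    if-does-elim (λ k → ∣ C x y ∣ ∸ 1 ≡ k) (x Fin.≟ y) (λ x≡y → contradiction x≡y x≢y) (λ _ → refl)

  h-diagonal : ∀ x → h x x ≡ 0
  h-diagonal x = if-does-elim (_≡ 0) (x Fin.≟ x) (λ _ → refl) (contradiction refl)

  ∣C∣-diagonal : ∀ x → ∣ C x x ∣ ∸ 1 ≡ 0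
  ∣C∣-diagonal x = cong (_∸ 1)
    (trans (cong (∣_∣ ∘ cluster) (lca-diagonal tree (∈-hierarchy x))) (∣⁅x⁆∣≡1 x))

-- Enumeration of hierarchies

toList-nonempty : (t : BinTree n) → 0 < length (toList t)
toList-nonempty t with _ , x∈t ← cluster-nonempty t with toList t | ∈-cluster⇒∈-toList t x∈t
... | _ ∷ _ | _ = s≤s z≤n

-- A node has fewer leaves on each side than in total, so bounding the height
-- by the number of leaves loses no tree; this gives a finite search space.
treesOfHeight≤ : ℕ → List (BinTree n)
treesOfHeight≤     zero    = []
treesOfHeight≤ {n} (suc k) =
  map leaf (allFin n) ++
  cartesianProductWith (λ l r → node l _ r) (treesOfHeight≤ k) (treesOfHeight≤ k)

∈-treesOfHeight≤ : ∀ (t : BinTree n) {k} → length (toList t) ≤ k → t ∈ˡ treesOfHeight≤ k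
∈-treesOfHeight≤ t {zero} ≤k = contradiction (ℕ.<-≤-trans (toList-nonempty t) ≤k) λ ()
∈-treesOfHeight≤ (leaf v) {suc k} ≤k = ∈-++⁺ˡ (∈-map⁺ leaf (∈-allFin v))
∈-treesOfHeight≤ {n} (node l u r) {suc k} ≤k =
  ∈-++⁺ʳ (map leaf (allFin n))
    (∈-cartesianProductWith⁺ _
      (∈-treesOfHeight≤ l (s≤s⁻¹ (ℕ.≤-trans (ℕ.m<m+n _ (toList-nonempty r)) ≤k′)))
      (∈-treesOfHeight≤ r (s≤s⁻¹ (ℕ.≤-trans (ℕ.m<n+m _ (toList-nonempty l)) ≤k′))))
  where
  ≤k′ = subst (_≤ suc k) (trans (cong length (toList-node l r)) (length-++ (toList l))) ≤k

-- Provides some hierarchy, from which the search for a best one can start.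
comb : Fin n → List (Fin n) → BinTree n
comb x []       = leaf x
comb x (y ∷ ys) = node (leaf x) _ (comb y ys)

toList-comb : ∀ (x : Fin n) xs → toList (comb x xs) ≡ x ∷ xs
toList-comb x []       = refl
toList-comb x (y ∷ ys) = cong (x ∷_) (toList-comb y ys)

-- Walks

module _ (G : Graph n) where
  open Graph G

  walk-mono : ∀ {S R k x y} → S ⊆ R → Walk S k x y → Walk R k x y
  walk-mono S⊆R (here x∈S)       = here (S⊆R x∈S)
  walk-mono S⊆R (step x∈S xy p)  = step (S⊆R x∈S) xy (walk-mono S⊆R p)

  walk-++ : ∀ {S k j x y z} → Walk S k x y → Walk S j y z → ∃[ i ] Walk S i x z
  walk-++ (here _)        q = _ , q
  walk-++ (step x∈S xy p) q = _ , step x∈S xy (proj₂ (walk-++ p q))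

  -- What follows the last visit to x on a walk in S that ends at z.
  LeavesForGood : Subset n → Fin n → Fin n → Set
  LeavesForGood S x z = x ≡ z ⊎ ∃[ y ] Adj x y × ∃[ k ] Walk (S - x) k y z

  -- Scan the walk from its end: either x does not occur, or its last
  -- occurrence is found.
  last-visit : ∀ {S k y z} x → Walk S k y z → (∃[ j ] Walk (S - x) j y z) ⊎ LeavesForGood S x z
  last-visit {y = y} x (here y∈S) with x Fin.≟ y
  ... | yes x≡y = inj₂ (inj₁ x≡y)
  ... | no  x≢y = inj₁ (_ , here (x∈p∧x≢y⇒x∈p-y y∈S (x≢y ∘ sym)))
  last-visit {y = y} x (step y∈S yy′ p) with last-visit x p | x Fin.≟ y
  ... | inj₂ leaves  | _        = inj₂ leaves
  ... | inj₁ q       | yes refl = inj₂ (inj₂ (_ , yy′ , q))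
  ... | inj₁ (_ , q) | no x≢y   = inj₁ (_ , step (x∈p∧x≢y⇒x∈p-y y∈S (x≢y ∘ sym)) yy′ q)

  -- Cutting a walk at the last visit to its start x leaves a remainder in
  -- S - x, which is shortened recursively; every edge kept uses up a vertex.
  shorten : ∀ {S k x z} → Walk S k x z → ∃[ j ] j < ∣ S ∣ × Walk S j x z
  shorten = go (<-wellFounded _)
    where
    go : ∀ {S k x z} → Acc _<_ ∣ S ∣ → Walk S k x z → ∃[ j ] j < ∣ S ∣ × Walk S j x z
    via : ∀ {S x z} → Acc _<_ ∣ S ∣ → x ∈ S → LeavesForGood S x z →
          ∃[ j ] j < ∣ S ∣ × Walk S j x z
    go a (here x∈S)        = via a x∈S (inj₁ refl)
    go a (step x∈S xy p)   =
      via a x∈S ([ (λ q → inj₂ (_ , xy , q)) , id ]′ (last-visit _ p))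
    via _        x∈S (inj₁ refl) = 0 , ℕ.≤-<-trans z≤n (x∈p⇒∣p-x∣<∣p∣ x∈S) , here x∈S
    via {S} {x} (acc rs) x∈S (inj₂ (y , xy , _ , p))
      with j , j< , q ← go (rs (x∈p⇒∣p-x∣<∣p∣ x∈S)) p =
      suc j , ℕ.≤-<-trans j< (x∈p⇒∣p-x∣<∣p∣ x∈S) , step x∈S xy (walk-mono (p─q⊆p S _) q)

-- Connected hierarchies dominate the distance

  module _ (conn : Connected) where
    open Metric G conn

    d≤length : ∀ {k x y} → Walk full k x y → d x y ≤ k
    d≤length {x = x} {y} = proj₂ (proj₂ (distance x y))

    d-diagonal : ∀ x → d x x ≡ 0
    d-diagonal x = ℕ.n≤0⇒n≡0 (d≤length (here ∈⊤))

    d≤diam : ∀ {S x y} → x ∈ S → y ∈ S → d x y ≤ diam S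
    d≤diam {S} {x} {y} x∈S y∈S =
      v≤max⁺ 0 _ (inj₂ (lose (∈-cartesianProductWith⁺ d (member x∈S) (member y∈S)) ℕ.≤-refl))
      where
      member : ∀ {v} → v ∈ S → v ∈ˡ filter (_∈? S) (allFin n)
      member = ∈-filter⁺ (_∈? S) (∈-allFin _)

    diam≤∣S∣∸1 : ∀ {S} → InducesConnected S → diam S ≤ ∣ S ∣ ∸ 1
    diam≤∣S∣∸1 {S} S-conn = max≤v⁺ z≤n (All.tabulate bound)
      where
      members = filter (_∈? S) (allFin n)
      bound : ∀ {k} → k ∈ˡ cartesianProductWith d members members → k ≤ ∣ S ∣ ∸ 1
      bound k∈
        with x , y , x∈ , y∈ , refl ← ∈-cartesianProductWith⁻ d members members k∈
        with _ , x∈S ← ∈-filter⁻ (_∈? S) {xs = allFin n} x∈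
           | _ , y∈S ← ∈-filter⁻ (_∈? S) {xs = allFin n} y∈
        with j , j< , p ← shorten (proj₂ (S-conn x∈S y∈S)) =
        ℕ.≤-trans (d≤length (walk-mono (λ _ → ∈⊤) p)) (ℕ.<⇒≤pred j<)

    module _ (T : Hierarchy n) (T-conn : Hierarchy.ConnectedClusters T G) where
      open Hierarchy T

      d≤diam-C : ∀ x y → d x y ≤ diam (C x y)
      d≤diam-C x y with x∈ , y∈ ← C-joins T x y = d≤diam x∈ y∈

      diam-C≤ : ∀ x y → diam (C x y) ≤ ∣ C x y ∣ ∸ 1
      diam-C≤ x y = diam≤∣S∣∸1 (T-conn (lca-subtree tree x y))

      d≤h : ∀ x y → d x y ≤ h x y
      d≤h x y with x Fin.≟ y
      ... | yes refl = ℕ.≤-reflexive (d-diagonal x)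
      ... | no  _    = ℕ.≤-trans (d≤diam-C x y) (diam-C≤ x y)

-- Splitting a hierarchy into connected components

  Touch Separated : BinTree n → BinTree n → Set
  Touch s t = ∃[ x ] x ∈ cluster s × ∃[ y ] y ∈ cluster t × Adj x y
  Separated s t = ¬ Touch s t

  touch? : ∀ s t → Dec (Touch s t)
  touch? s t = Fin.any? λ x → (x ∈? cluster s) ×-dec
               Fin.any? λ y → (y ∈? cluster t) ×-dec adj? x y

  AllConnected : BinTree n → Set
  AllConnected t = ∀ {s} → s IsSubtreeOf t → InducesConnected (cluster s)

  merge-connected : ∀ {s t} → AllConnected s → AllConnected t → Touch s t → AllConnected (node s _ t)
  merge-connected s-conn t-conn _ (left  v⊑s) = s-conn v⊑s
  merge-connected s-conn t-conn _ (right v⊑t) = t-conn v⊑t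
  merge-connected {s} {t} s-conn t-conn (a , a∈s , b , b∈t , ab) root x∈ y∈
    with x∈p∪q⁻ (cluster s) (cluster t) x∈ | x∈p∪q⁻ (cluster s) (cluster t) y∈
  ... | inj₁ x∈s | inj₁ y∈s = _ , walk-mono (p⊆p∪q (cluster t)) (proj₂ (s-conn root x∈s y∈s))
  ... | inj₂ x∈t | inj₂ y∈t = _ , walk-mono (q⊆p∪q (cluster s) _) (proj₂ (t-conn root x∈t y∈t))
  ... | inj₁ x∈s | inj₂ y∈t =
    walk-++ (walk-mono (p⊆p∪q (cluster t)) (proj₂ (s-conn root x∈s a∈s)))
      (step (p⊆p∪q (cluster t) a∈s) ab
        (walk-mono (q⊆p∪q (cluster s) _) (proj₂ (t-conn root b∈t y∈t))))
  ... | inj₂ x∈t | inj₁ y∈s =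
    walk-++ (walk-mono (q⊆p∪q (cluster s) _) (proj₂ (t-conn root x∈t b∈t)))
      (step (q⊆p∪q (cluster s) _ b∈t) (symm ab)
        (walk-mono (p⊆p∪q (cluster t)) (proj₂ (s-conn root a∈s y∈s))))

  -- A tree absorbs, one after another, all trees of the forest it touches.
  -- In a separated forest one pass is enough: a tree skipped earlier touches
  -- neither the tree that is inserted nor anything absorbed later.
  insert : BinTree n → List (BinTree n) → List (BinTree n)
  insert s []      = s ∷ []
  insert s (t ∷ F) with touch? s t
  ... | yes _ = insert (node s _ t) F
  ... | no  _ = t ∷ insert s F

  -- The connected components of the cluster of a tree, each one arranged as a
  -- hierarchy of connected clusters.
  components : BinTree n → List (BinTree n)
  components (leaf v)     = leaf v ∷ []
  components (node l _ r) = foldr insert (components r) (components l)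

  insert-all : ∀ {p} {P : BinTree n → Set p} →
               (∀ {s t} → P s → P t → Touch s t → P (node s _ t)) →
               ∀ {s F} → P s → All P F → All P (insert s F)
  insert-all merge ps [] = ps ∷ []
  insert-all merge {s} ps (_∷_ {t} pt pF) with touch? s t
  ... | yes st = insert-all merge (merge ps pt st) pF
  ... | no  _  = pt ∷ insert-all merge ps pF

  insert-separated : ∀ {s F} → AllPairs Separated F → AllPairs Separated (insert s F)
  insert-separated [] = [] ∷ []
  insert-separated {s} (_∷_ {t} t-sep F-sep) with touch? s t
  ... | yes _  = insert-separated F-sep
  ... | no ¬st =
    insert-all (λ {a} {b} → separated-merge {a} {b})
      (λ (x , x∈t , y , y∈s , xy) → ¬st (y , y∈s , x , x∈t , symm xy)) t-sep
    ∷ insert-separated F-sep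
    where
    separated-merge : ∀ {s s′} → Separated t s → Separated t s′ → Touch s s′ →
                      Separated t (node s _ s′)
    separated-merge {s} {s′} ts ts′ _ (x , x∈t , y , y∈ , xy) =
      [ (λ y∈s → ts (x , x∈t , y , y∈s , xy)) , (λ y∈s′ → ts′ (x , x∈t , y , y∈s′ , xy)) ]′
        (x∈p∪q⁻ (cluster s) (cluster s′) y∈)

  insert-leaves : ∀ s F → concatMap toList (insert s F) ↭ toList s ++ concatMap toList F
  insert-leaves s []      = ↭-refl
  insert-leaves s (t ∷ F) with touch? s t
  ... | yes _ = begin
    concatMap toList (insert (node s _ t) F)     ↭⟨ insert-leaves (node s _ t) F ⟩
    toList (node s _ t) ++ concatMap toList F    ≡⟨ cong (_++ concatMap toList F) (toList-node s t) ⟩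
    (toList s ++ toList t) ++ concatMap toList F ≡⟨ ++-assoc (toList s) _ _ ⟩
    toList s ++ toList t ++ concatMap toList F   ∎
    where open PermutationReasoning
  ... | no _ = begin
    toList t ++ concatMap toList (insert s F)  ↭⟨ ++⁺ˡ (toList t) (insert-leaves s F) ⟩
    toList t ++ toList s ++ concatMap toList F ↭⟨ shifts (toList t) (toList s) ⟩
    toList s ++ toList t ++ concatMap toList F ∎
    where open PermutationReasoning

  Occurs : BinTree n → List (BinTree n) → Set
  Occurs v F = Any (v IsSubtreeOf_) F

  insert-occurs : ∀ {v} s F → Occurs v (s ∷ F) → Occurs v (insert s F)
  insert-occurs s []      v∈ = v∈
  insert-occurs s (t ∷ F) v∈ with touch? s t | v∈
  ... | yes _ | here v⊑s          = insert-occurs (node s _ t) F (here (left v⊑s))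
  ... | yes _ | there (here v⊑t)  = insert-occurs (node s _ t) F (here (right v⊑t))
  ... | yes _ | there (there v∈F) = insert-occurs (node s _ t) F (there v∈F)
  ... | no  _ | here v⊑s          = there (insert-occurs s F (here v⊑s))
  ... | no  _ | there (here v⊑t)  = here v⊑t
  ... | no  _ | there (there v∈F) = there (insert-occurs s F (there v∈F))

  occurs-right : ∀ {v} E {F} → Occurs v F → Occurs v (foldr insert F E)
  occurs-right []      v∈F = v∈F
  occurs-right (s ∷ E) v∈F = insert-occurs s _ (there (occurs-right E v∈F))

  occurs-left : ∀ {v E} F → Occurs v E → Occurs v (foldr insert F E)
  occurs-left {E = s ∷ E} F (here v⊑s)  = insert-occurs s (foldr insert F E) (here v⊑s)
  occurs-left {E = s ∷ E} F (there v∈E) = insert-occurs s _ (there (occurs-left F v∈E))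

  components-separated : ∀ t → AllPairs Separated (components t)
  components-separated (leaf v)     = [] ∷ []
  components-separated (node l _ r) = go (components l)
    where
    go : ∀ E → AllPairs Separated (foldr insert (components r) E)
    go []      = components-separated r
    go (s ∷ E) = insert-separated (go E)

  components-connected : ∀ t → All AllConnected (components t)
  components-connected (leaf v) = leaf-connected ∷ []
    where
    leaf-connected : AllConnected (leaf v)
    leaf-connected root x∈ y∈ with refl ← x∈⁅y⁆⇒x≡y v x∈ | refl ← x∈⁅y⁆⇒x≡y v y∈ = 0 , here x∈
  components-connected (node l _ r) = go (components-connected l)
    where
    go : ∀ {E} → All AllConnected E → All AllConnected (foldr insert (components r) E)
    go []       = components-connected r
    go (s ∷ cE) = insert-all merge-connected s (go cE)

  components-leaves : ∀ t → concatMap toList (components t) ↭ toList t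
  components-leaves (leaf v)     = ↭-refl
  components-leaves (node l u r) = begin
    concatMap toList (foldr insert (components r) (components l))          ↭⟨ go (components l) ⟩
    concatMap toList (components l) ++ concatMap toList (components r)
      ↭⟨ ++⁺ (components-leaves l) (components-leaves r) ⟩
    toList l ++ toList r                                                   ≡⟨ toList-node l r ⟨
    toList (node l u r)                                                    ∎
    where
    open PermutationReasoning
    go : ∀ E → concatMap toList (foldr insert (components r) E) ↭
               concatMap toList E ++ concatMap toList (components r)
    go []      = ↭-refl
    go (s ∷ E) = begin
      concatMap toList (insert s (foldr insert (components r) E))
        ↭⟨ insert-leaves s (foldr insert (components r) E) ⟩
      toList s ++ concatMap toList (foldr insert (components r) E)          ↭⟨ ++⁺ˡ (toList s) (go E) ⟩
      toList s ++ concatMap toList E ++ concatMap toList (components r)     ≡⟨ ++-assoc (toList s) _ _ ⟨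
      (toList s ++ concatMap toList E) ++ concatMap toList (components r)   ∎

  components-cover : ∀ t {x} → x ∈ cluster t → ∃[ s ] s ∈ˡ components t × x ∈ cluster s
  components-cover t x∈t
    with s , s∈ , x∈s ← find (∈-concatMap⁻ toList {xs = components t}
                           (∈-resp-↭ (↭-sym (components-leaves t)) (∈-cluster⇒∈-toList t x∈t))) =
    s , s∈ , ∈-toList⇒∈-cluster s x∈s

  component⊆ : ∀ t {s} → s ∈ˡ components t → cluster s ⊆ cluster t
  component⊆ t {s} s∈ x∈s = ∈-toList⇒∈-cluster t
    (∈-resp-↭ (components-leaves t) (∈-concatMap⁺ toList (lose s∈ (∈-cluster⇒∈-toList s x∈s))))

  separated⇒same : ∀ {F s t x y} → AllPairs Separated F → s ∈ˡ F → t ∈ˡ F →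
                   x ∈ cluster s → y ∈ cluster t → Adj x y → s ≡ t
  separated⇒same (_ ∷ _)     (here refl) (here refl) _   _   _  = refl
  separated⇒same (sep ∷ _)   (here refl) (there t∈F) x∈s y∈t xy =
    contradiction (_ , x∈s , _ , y∈t , xy) (All.lookup sep t∈F)
  separated⇒same (sep ∷ _)   (there s∈F) (here refl) x∈s y∈t xy =
    contradiction (_ , y∈t , _ , x∈s , symm xy) (All.lookup sep s∈F)
  separated⇒same (_ ∷ F-sep) (there s∈F) (there t∈F) x∈s y∈t xy =
    separated⇒same F-sep s∈F t∈F x∈s y∈t xy

  -- The component that contains y touches the one that contains x, so they
  -- are equal by separation.
  component-closed : ∀ t {s x y} → s ∈ˡ components t → x ∈ cluster s → y ∈ cluster t → Adj x y →
                     y ∈ cluster s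
  component-closed t s∈ x∈s y∈t xy
    with s′ , s′∈ , y∈s′ ← components-cover t y∈t
    with refl ← separated⇒same (components-separated t) s∈ s′∈ x∈s y∈s′ xy = y∈s′

  -- At the root of t the component of x works, as it contains y as well;
  -- further down, the subtree found survives all later merges.
  components-refine : ∀ {t v x y} → Adj x y → v IsSubtreeOf t → Joins v x y →
                      ∃[ v′ ] Occurs v′ (components t) × Joins v′ x y × cluster v′ ⊆ cluster v
  components-refine {t} xy root (x∈t , y∈t) with s , s∈ , x∈s ← components-cover t x∈t =
    s , lose s∈ root , (x∈s , component-closed t s∈ x∈s y∈t xy) , component⊆ t s∈
  components-refine {node l _ r} xy (left v⊑l) v∋ with v′ , occ , rest ← components-refine xy v⊑l v∋ =
    v′ , occurs-left (components r) occ , rest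
  components-refine {node l _ r} xy (right v⊑r) v∋ with v′ , occ , rest ← components-refine xy v⊑r v∋ =
    v′ , occurs-right (components l) occ , rest

  -- At the root of a hierarchy every vertex is a leaf, so the closure property
  -- applies to all edges of G.
  component-walk : ∀ (T : Hierarchy n) {s k x y} → let open Hierarchy T in
                   s ∈ˡ components tree → x ∈ cluster s → Walk full k x y → y ∈ cluster s
  component-walk T s∈ x∈s (here _)      = x∈s
  component-walk T s∈ x∈s (step _ xy p) =
    component-walk T s∈ (component-closed (Hierarchy.tree T) s∈ x∈s (∈-hierarchy T _) xy) p

  -- Comparing clusters on edges alone suffices for the cost, and it is all
  -- that can be hoped for: vertices that are not adjacent may lie in one
  -- small disconnected cluster of T.
  record Improvement (T : Hierarchy n) : Set where
    field
      hierarchy : Hierarchy n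
      connected : Hierarchy.ConnectedClusters hierarchy G
      C⊆        : ∀ {x y} → Adj x y → Hierarchy.C hierarchy x y ⊆ Hierarchy.C T x y

  improve : Connected → Fin n → ∀ T → Improvement T
  improve conn v₀ T = go (components tree) refl
    where
    open Hierarchy T
    go : ∀ F → components tree ≡ F → Improvement T
    go [] eq with _ , s∈ , _ ← components-cover tree (∈-hierarchy T v₀)
             with () ← subst (_ ∈ˡ_) eq s∈
    -- By connectedness of G the first component contains all vertices, in
    -- particular a leaf of the second one, but no leaf occurs twice.
    go (s ∷ t ∷ F) eq = contradiction (∈-++⁺ˡ (∈-cluster⇒∈-toList t y∈t))
        (unique-++⇒disjoint (toList s) F-unique (∈-cluster⇒∈-toList s y∈s))
      where
      x∈s = proj₂ (cluster-nonempty s)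
      y∈t = proj₂ (cluster-nonempty t)
      y∈s = component-walk T (subst (s ∈ˡ_) (sym eq) (here refl)) x∈s (proj₂ (conn ∈⊤ ∈⊤))
      F-unique : Unique (concatMap toList (s ∷ t ∷ F))
      F-unique = subst (Unique ∘ concatMap toList) eq
        (Permutationₛ.Unique-resp-↭ (setoid (Fin n)) (↭⇒↭ₛ (↭-sym (components-leaves tree)))
          (hierarchy-unique T))
    go (s ∷ []) eq = record
      { hierarchy = T′
      ; connected = λ v⊑s → All.head (subst (All AllConnected) eq (components-connected tree)) v⊑s
      ; C⊆        = λ {x} {y} → shrink x y
      }
      where
      T′ : Hierarchy n
      T′ = record
        { tree    = s
        ; leaves↭ = ↭-trans (↭-reflexive (trans (sym (++-identityʳ (toList s)))
                                                (cong (concatMap toList) (sym eq))))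
                            (↭-trans (components-leaves tree) leaves↭)
        }
      shrink : ∀ x y → Adj x y → Hierarchy.C T′ x y ⊆ C x y
      shrink x y xy
        with v , occ , v∋ , v⊆ ← components-refine xy (lca-subtree tree x y) (C-joins T x y)
        with here v⊑s ← subst (Occurs v) eq occ =
        v⊆ ∘ lca-minimal (hierarchy-unique T′) v⊑s v∋

-- Ordered fields

module _ {c ℓ₁ ℓ₂} (K : OrderedField c ℓ₁ ℓ₂) where
  open OrderedField K hiding (refl; sym; trans; setoid)
  private
    module ≈ = OrderedField K
    totalOrder : TotalOrder c ℓ₁ ℓ₂
    totalOrder = record { isTotalOrder = isTotalOrder }
    module ≤ = TotalOrder totalOrder
  open RingProperties ring using (-1*x≈-x; x[y-z]≈xy-xz)
  open GroupProperties +-group using (⁻¹-involutive)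

  +-mono-≤ᶠ : ∀ {x y u v} → x ≤ᶠ y → u ≤ᶠ v → x + u ≤ᶠ y + v
  +-mono-≤ᶠ {x} {y} {u} {v} x≤y u≤v =
    ≤.trans (+-monoʳ-≤ᶠ x u≤v)
      (≤.≤-respʳ-≈ (+-comm v y) (≤.≤-respˡ-≈ (+-comm v x) (+-monoʳ-≤ᶠ v x≤y)))

  x≤y⇒0≤y-x : ∀ {x y} → x ≤ᶠ y → 0# ≤ᶠ y + - x
  x≤y⇒0≤y-x {x} {y} x≤y =
    ≤.≤-respʳ-≈ (+-comm (- x) y) (≤.≤-respˡ-≈ (-‿inverseˡ x) (+-monoʳ-≤ᶠ (- x) x≤y))

  0≤y-x⇒x≤y : ∀ {x y} → 0# ≤ᶠ y + - x → x ≤ᶠ y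
  0≤y-x⇒x≤y {x} {y} 0≤ =
    ≤.≤-respʳ-≈ (≈.trans (≈.sym (+-assoc x y (- x)))
                  (≈.trans (+-congʳ (+-comm x y))
                    (≈.trans (+-assoc y x (- x))
                      (≈.trans (+-congˡ (-‿inverseʳ x)) (+-identityʳ y)))))
      (≤.≤-respˡ-≈ (+-identityʳ x) (+-monoʳ-≤ᶠ x 0≤))

  *-monoʳ-≤ᶠ : ∀ {z x y} → 0# ≤ᶠ z → x ≤ᶠ y → z * x ≤ᶠ z * y
  *-monoʳ-≤ᶠ {z} {x} {y} 0≤z x≤y =
    0≤y-x⇒x≤y (≤.≤-respʳ-≈ (x[y-z]≈xy-xz z y x) (*-nonneg 0≤z (x≤y⇒0≤y-x x≤y)))

  -- By totality of the order: if 1 is at most 0, then 1 is the square of the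
  -- nonnegative element -1.
  0≤1 : 0# ≤ᶠ 1#
  0≤1 with ≤.total 0# 1#
  ... | inj₁ 0≤1 = 0≤1
  ... | inj₂ 1≤0 = ≤.≤-respʳ-≈ (≈.trans (-1*x≈-x (- 1#)) (⁻¹-involutive 1#)) (*-nonneg 0≤-1 0≤-1)
    where
    0≤-1 : 0# ≤ᶠ - 1#
    0≤-1 = ≤.≤-respʳ-≈ (+-identityˡ (- 1#)) (x≤y⇒0≤y-x 1≤0)

  fromℕ-mono : ∀ {j k} → j ≤ k → fromℕ j ≤ᶠ fromℕ k
  fromℕ-mono {k = zero}  z≤n       = ≤.refl
  fromℕ-mono {k = suc k} z≤n       =
    ≤.≤-respˡ-≈ (+-identityˡ 0#) (+-mono-≤ᶠ 0≤1 (fromℕ-mono {k = k} z≤n))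
  fromℕ-mono             (s≤s j≤k) = +-monoʳ-≤ᶠ 1# (fromℕ-mono j≤k)

  sum-mono : ∀ {a} {A : Set a} {f g : A → Carrier} {xs} →
             All (λ x → f x ≤ᶠ g x) xs → sum (map f xs) ≤ᶠ sum (map g xs)
  sum-mono []       = ≤.refl
  sum-mono (p ∷ ps) = +-mono-≤ᶠ p (sum-mono ps)

-- Minima over hierarchies

  -- A vertex is required because there is no hierarchy on the empty set.
  hierarchy-argmin : (f : BinTree n → Carrier) → Fin n →
                     ∃[ T ] ∀ (H : Hierarchy n) → f (Hierarchy.tree T) ≤ᶠ f (Hierarchy.tree H)
  hierarchy-argmin {suc n} f _ = record { tree = best ; leaves↭ = best↭ } , best≤
    where
    open Extrema totalOrder using (argmin; argmin-all; f[argmin]≤f[xs])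
    isHierarchy? : (t : BinTree (suc n)) → Dec (toList t ↭ allFin (suc n))
    isHierarchy? t = _↭?_ Fin._≟_ (toList t) (allFin (suc n))
    default = comb Fin.zero (tabulate Fin.suc)
    candidates = filter isHierarchy? (treesOfHeight≤ (suc n))
    best = argmin f default candidates
    best↭ : toList best ↭ allFin (suc n)
    best↭ = argmin-all f {P = λ t → toList t ↭ allFin (suc n)}
              (↭-reflexive (toList-comb Fin.zero _))
              (all-filter isHierarchy? (treesOfHeight≤ (suc n)))
    best≤ : ∀ H → f best ≤ᶠ f (Hierarchy.tree H)
    best≤ H = All.lookup (f[argmin]≤f[xs] default candidates)
      (∈-filter⁺ isHierarchy?
        (∈-treesOfHeight≤ tree {suc n}
          (ℕ.≤-reflexive (trans (↭-length leaves↭) (length-tabulate {n = suc n} id))))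
        leaves↭)
      where open Hierarchy H

  module _ (G : WeightedGraph K n) where
    open WeightedGraph G

    edges-adjacent : All (λ (x , y) → Adj x y) edges
    edges-adjacent = All.map proj₂
      (all-filter (λ (x , y) → (x Fin.<? y) ×-dec adj? x y) (cartesianProduct (allFin n) (allFin n)))

    edgeSum-mono : ∀ {f g} → (∀ {x y} → Adj x y → f x y ≤ g x y) → edgeSum f ≤ᶠ edgeSum g
    edgeSum-mono f≤g =
      sum-mono (All.map (λ xy → *-monoʳ-≤ᶠ (proj₁ (w-pos xy)) (fromℕ-mono (f≤g xy))) edges-adjacent)

    edgeSum-cong : ∀ {f g} → (∀ {x y} → Adj x y → f x y ≡ g x y) → edgeSum f ≡ edgeSum g
    edgeSum-cong f≡g =
      cong sum (map-cong-local (All.map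
        (λ {(x , y)} adj → cong (λ k → w x y * fromℕ k) (f≡g adj)) edges-adjacent))

    dasgupta : BinTree n → Carrier
    dasgupta t = edgeSum (λ x y → ∣ cluster (lca t x y) ∣ ∸ 1)

    -- Edges are never loops, so only the values of h off the diagonal enter.
    edgeSum-h : ∀ T → edgeSum (Hierarchy.h T) ≡ dasgupta (Hierarchy.tree T)
    edgeSum-h T = edgeSum-cong λ xy → sym (h-off-diagonal T λ x≡y → irrefl x≡y xy)

    common-optimum : (conn : Connected) → Fin n →
                     ∃[ opt ] IsOPT-D⁻ opt × IsOPT-card conn opt × IsOPT-conn opt
    common-optimum conn v₀ with T , T-min ← hierarchy-argmin dasgupta v₀ =
      dasgupta (Hierarchy.tree T*) ,
      ((T* , _ , ≈.refl) , λ H _ → opt≤ H) ,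
      ((T* , d≤h graph conn T* connected , h-cost) , λ H _ → opt≤h H) ,
      ((T* , connected , h-cost) , λ H _ → opt≤h H)
      where
      open Improvement (improve graph conn v₀ T) renaming (hierarchy to T*)
      h-cost = ≈.reflexive (edgeSum-h T*)
      opt≤ : ∀ H → dasgupta (Hierarchy.tree T*) ≤ᶠ dasgupta (Hierarchy.tree H)
      opt≤ H = ≤.trans (edgeSum-mono λ xy → ℕ.∸-monoˡ-≤ 1 (p⊆q⇒∣p∣≤∣q∣ (C⊆ xy))) (T-min H)
      opt≤h : ∀ H → dasgupta (Hierarchy.tree T*) ≤ᶠ edgeSum (Hierarchy.h H)
      opt≤h H = subst (dasgupta (Hierarchy.tree T*) ≤ᶠ_) (sym (edgeSum-h H)) (opt≤ H)

corollary4 :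
    ∀ {c ℓ₁ ℓ₂} (K : OrderedField c ℓ₁ ℓ₂) (n : ℕ) → 2 ≤ n →
    (G : WeightedGraph K n) (conn : WeightedGraph.Connected G) →
    let open WeightedGraph G
        open Metric graph conn
    in
    (∃[ opt ] IsOPT-D⁻ opt × IsOPT-card conn opt × IsOPT-conn opt)
    ×
    (∀ (T : Hierarchy n) → Hierarchy.ConnectedClusters T graph →
      let open Hierarchy T in
      (∀ x y → x ≢ y →
        d x y ≤ diam (C x y) ×
        diam (C x y) ≤ ∣ C x y ∣ ∸ 1 ×
        ∣ C x y ∣ ∸ 1 ≡ h x y)
      ×
      (∀ x →
        d x x ≡ 0 ×
        diam (C x x) ≡ 0 ×
        ∣ C x x ∣ ∸ 1 ≡ 0 ×
        h x x ≡ 0)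
      ×
      (∀ x y → d x y ≤ h x y))
corollary4 K n 2≤n G conn =
  common-optimum K G conn (Fin.fromℕ< 2≤n) ,
  λ T T-conn →
    (λ x y x≢y → d≤diam-C graph conn T T-conn x y ,
                 diam-C≤ graph conn T T-conn x y ,
                 h-off-diagonal T x≢y) ,
    (λ x → d-diagonal graph conn x ,
           ℕ.n≤0⇒n≡0 (subst (diam (Hierarchy.C T x x) ≤_) (∣C∣-diagonal T x) (diam-C≤ graph conn T T-conn x x)) ,
           ∣C∣-diagonal T x ,
           h-diagonal T x) ,
    d≤h graph conn T T-conn
  where
  open WeightedGraph G
  open Metric graph conn
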